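{- Let $\alpha_1,\alpha_2,\alpha_3\ge 0$ and $\beta_1,\beta_2,\beta_3>0$ be real numbers. The pseudo-paradox occurs in the asymmetrical network configuration $A/A^+$ with these parameters for any total flow $Q>0$; that is, $T^+_{Eq}=T_{Eq}$ for every $Q>0$.
   Context: The network $A^+$ has nodes $a,b,c,d$ and directed links $(a,b),(b,d),(b,c),(a,c),(c,d)$ with travel times $\alpha_1+\beta_1f_{ab}$, $\alpha_2+\beta_2f_{bd}$, $\alpha_3+\beta_3f_{bc}$, $\alpha_1+\beta_1f_{ac}$, $\alpha_2+\beta_2f_{cd}$ respectively, where $f_{ij}\ge 0$ is the (real) flow on link $(i,j)$ and $\alpha_i\ge 0$, $\beta_i>0$. All traffic, of total amount $Q>0$ (real), goes from $a$ to $d$ along the paths $P_1=a-b-d$, $P_2=a-c-d$, $P_3=a-b-c-d$. The network $A$ is $A^+$ with the link $(b,c)$ removed, so its paths are $P_1,P_2$ only. A flow assigns a non-negative real amount to each path, with total $Q$; the flow on a link is the sum of the flows of the paths containing it; the travel time on a path is the sum of the travel times of its links. A path has vanishing flow if its path flow is $0$. A network is at equilibrium if all paths with non-vanishing flow have the same travel time, and every path with vanishing flow has travel time at least this common value. The equilibrium exists and is unique; its common travel time is denoted $T_{Eq}$ for $A$ and $T^+_{Eq}$ for $A^+$ (both are functions of $Q$). The pseudo-paradox is said to occur in $A/A^+$ if $T^+_{Eq}=T_{Eq}$ for an interval of values of $Q$ (as opposed to a single point); it occurs for a given $Q$ if $Q$ belongs to such a non-degenerate interval. -}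

module Defs where

open import Algebra.Bundles using (CommutativeMonoid)
import Algebra.Properties.CommutativeSemigroup as CommutativeSemigroupProperties
import Algebra.Properties.Ring as RingProperties
open import Data.Bool using (Bool; false; _∧_; _∨_)
open import Data.Fin using (Fin; _≟_)
open import Data.Fin.Patterns using (0F; 1F; 2F; 3F)
open import Data.List using (List; []; _∷_; map; foldr; filterᵇ)
open import Data.List.Membership.Propositional using (_∈_)
open import Data.List.Relation.Unary.Any using (here; there)
open import Data.List.Relation.Unary.All using (All; []; _∷_)
open import Data.List.Relation.Unary.AllPairs using ([]; _∷_)
open import Data.List.Relation.Unary.Unique.Propositional using (Unique)
open import Data.Nat as ℕ using (ℕ)
import Data.Nat.Properties as ℕ
open import Data.Product using (Σ-syntax; ∃-syntax; _×_; _,_)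
open import Data.Rational as ℚ using (ℚ; 0ℚ; 1ℚ; ½; ∣_∣; 1/_)
import Data.Rational.Properties as ℚ
open import Relation.Binary.Construct.Closure.ReflexiveTransitive using (Star; ε; _◅_)
open import Relation.Binary.PropositionalEquality
open import Relation.Nullary using (¬_; does)

-- Real numbers: Cauchy sequences of rationals, with the equality _≈_ below.

Eventually : (ℕ → Set) → Set
Eventually P = ∃[ N ] (∀ n → N ℕ.≤ n → P n)

Cauchy : (ℕ → ℚ) → Set
Cauchy x = ∀ e → 0ℚ ℚ.< e →
  ∃[ N ] (∀ m n → N ℕ.≤ m → N ℕ.≤ n → ∣ x m ℚ.- x n ∣ ℚ.< e)

record ℝ : Set where
  constructor mkℝ
  field
    seq    : ℕ → ℚ
    cauchy : Cauchy seq

open ℝ public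

infix 4 _≈_ _<_ _≤_

_≈_ : ℝ → ℝ → Set
x ≈ y = ∀ e → 0ℚ ℚ.< e → Eventually λ n → ∣ seq x n ℚ.- seq y n ∣ ℚ.< e

_<_ : ℝ → ℝ → Set
x < y = ∃[ e ] (0ℚ ℚ.< e × Eventually λ n → seq x n ℚ.+ e ℚ.< seq y n)

_≤_ : ℝ → ℝ → Set
x ≤ y = ¬ (y < x)

private
  +-interchange : ∀ p q r s → (p ℚ.+ q) ℚ.- (r ℚ.+ s) ≡ (p ℚ.- r) ℚ.+ (q ℚ.- s)
  +-interchange p q r s = trans
    (cong ((p ℚ.+ q) ℚ.+_) (ℚ.neg-distrib-+ r s))
    (CommutativeSemigroupProperties.interchange
      (CommutativeMonoid.commutativeSemigroup ℚ.+-0-commutativeMonoid) p q (ℚ.- r) (ℚ.- s))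

  cancel : ∀ p q → (p ℚ.- q) ℚ.+ q ≡ p
  cancel p q = trans (ℚ.+-assoc p (ℚ.- q) q)
    (trans (cong (p ℚ.+_) (ℚ.+-inverseˡ q)) (ℚ.+-identityʳ p))

  *-telescope : ∀ p q r s → p ℚ.* q ℚ.- r ℚ.* s ≡ p ℚ.* (q ℚ.- s) ℚ.+ s ℚ.* (p ℚ.- r)
  *-telescope p q r s = sym (begin
    p ℚ.* (q ℚ.- s) ℚ.+ s ℚ.* (p ℚ.- r)
      ≡⟨ cong (p ℚ.* (q ℚ.- s) ℚ.+_) (ℚ.*-comm s (p ℚ.- r)) ⟩
    p ℚ.* (q ℚ.- s) ℚ.+ (p ℚ.- r) ℚ.* s
      ≡⟨ cong₂ ℚ._+_ (x[y-z]≈xy-xz p q s) ([y-z]x≈yx-zx s p r) ⟩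
    (p ℚ.* q ℚ.- p ℚ.* s) ℚ.+ (p ℚ.* s ℚ.- r ℚ.* s)
      ≡⟨ ℚ.+-assoc (p ℚ.* q ℚ.- p ℚ.* s) (p ℚ.* s) (ℚ.- (r ℚ.* s)) ⟨
    (p ℚ.* q ℚ.- p ℚ.* s) ℚ.+ p ℚ.* s ℚ.- r ℚ.* s
      ≡⟨ cong (ℚ._- r ℚ.* s) (cancel (p ℚ.* q) (p ℚ.* s)) ⟩
    p ℚ.* q ℚ.- r ℚ.* s ∎)
    where
    open ≡-Reasoning
    open RingProperties ℚ.+-*-ring using (x[y-z]≈xy-xz; [y-z]x≈yx-zx)

  half-pos : ∀ {e} → 0ℚ ℚ.< e → 0ℚ ℚ.< ½ ℚ.* e
  half-pos {e} 0<e = subst (ℚ._< ½ ℚ.* e) (ℚ.*-zeroʳ ½) (ℚ.*-monoʳ-<-pos ½ 0<e)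

  half+half : ∀ e → ½ ℚ.* e ℚ.+ ½ ℚ.* e ≡ e
  half+half e = trans (sym (ℚ.*-distribʳ-+ e ½ ½)) (ℚ.*-identityˡ e)

  const-cauchy : ∀ q → Cauchy (λ _ → q)
  const-cauchy q e 0<e = 0 , λ _ _ _ _ →
    subst (λ r → ∣ r ∣ ℚ.< e) (sym (ℚ.+-inverseʳ q)) 0<e

  ⊔-split : ∀ {M N n} → M ℕ.⊔ N ℕ.≤ n → M ℕ.≤ n × N ℕ.≤ n
  ⊔-split {M} {N} h = ℕ.≤-trans (ℕ.m≤m⊔n M N) h , ℕ.≤-trans (ℕ.m≤n⊔m M N) h

  +-cauchy : ∀ {x y} → Cauchy x → Cauchy y → Cauchy (λ n → x n ℚ.+ y n)
  +-cauchy {x} {y} cx cy e 0<e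
    with cx (½ ℚ.* e) (half-pos 0<e) | cy (½ ℚ.* e) (half-pos 0<e)
  ... | M , hx | N , hy = M ℕ.⊔ N , bound
    where
    open ℚ.≤-Reasoning
    bound : ∀ m n → M ℕ.⊔ N ℕ.≤ m → M ℕ.⊔ N ℕ.≤ n →
            ∣ (x m ℚ.+ y m) ℚ.- (x n ℚ.+ y n) ∣ ℚ.< e
    bound m n hm hn with ⊔-split {M} {N} hm | ⊔-split {M} {N} hn
    ... | Mm , Nm | Mn , Nn = begin-strict
      ∣ (x m ℚ.+ y m) ℚ.- (x n ℚ.+ y n) ∣
        ≡⟨ cong ∣_∣ (+-interchange (x m) (y m) (x n) (y n)) ⟩
      ∣ (x m ℚ.- x n) ℚ.+ (y m ℚ.- y n) ∣
        ≤⟨ ℚ.∣p+q∣≤∣p∣+∣q∣ (x m ℚ.- x n) (y m ℚ.- y n) ⟩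
      ∣ x m ℚ.- x n ∣ ℚ.+ ∣ y m ℚ.- y n ∣
        <⟨ ℚ.+-mono-< (hx m n Mm Mn) (hy m n Nm Nn) ⟩
      ½ ℚ.* e ℚ.+ ½ ℚ.* e
        ≡⟨ half+half e ⟩
      e ∎

  Bound : (ℕ → ℚ) → ℚ → Set
  Bound x B = 0ℚ ℚ.< B × Eventually λ n → ∣ x n ∣ ℚ.≤ B

  cauchy-bounded : ∀ {x} → Cauchy x → ∃[ B ] Bound x B
  cauchy-bounded {x} cx with cx 1ℚ (ℚ.positive⁻¹ 1ℚ)
  ... | N , h = 1ℚ ℚ.+ ∣ x N ∣
              , ℚ.+-mono-<-≤ (ℚ.positive⁻¹ 1ℚ) (ℚ.0≤∣p∣ (x N))
              , N , λ n N≤n → begin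
      ∣ x n ∣
        ≡⟨ cong ∣_∣ (sym (cancel (x n) (x N))) ⟩
      ∣ (x n ℚ.- x N) ℚ.+ x N ∣
        ≤⟨ ℚ.∣p+q∣≤∣p∣+∣q∣ (x n ℚ.- x N) (x N) ⟩
      ∣ x n ℚ.- x N ∣ ℚ.+ ∣ x N ∣
        ≤⟨ ℚ.+-monoˡ-≤ ∣ x N ∣ (ℚ.<⇒≤ (h n N N≤n ℕ.≤-refl)) ⟩
      1ℚ ℚ.+ ∣ x N ∣ ∎
    where
    open ℚ.≤-Reasoning

  pos-quotient : ∀ {B e} → 0ℚ ℚ.< B → 0ℚ ℚ.< e → ∃[ δ ] (0ℚ ℚ.< δ × B ℚ.* δ ≡ e)
  pos-quotient {B} {e} 0<B 0<e = B⁻¹ ℚ.* e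
    , subst (ℚ._< B⁻¹ ℚ.* e) (ℚ.*-zeroʳ B⁻¹) (ℚ.*-monoʳ-<-pos B⁻¹ 0<e)
    , trans (sym (ℚ.*-assoc B B⁻¹ e))
            (trans (cong (ℚ._* e) (ℚ.*-inverseʳ B)) (ℚ.*-identityˡ e))
    where
    instance
      B-pos : ℚ.Positive B
      B-pos = ℚ.positive 0<B
      B-nonZero : ℚ.NonZero B
      B-nonZero = ℚ.pos⇒nonZero B
    B⁻¹ : ℚ
    B⁻¹ = 1/ B
    instance
      B⁻¹-pos : ℚ.Positive B⁻¹
      B⁻¹-pos = ℚ.1/pos⇒pos B

  ∣*∣-bound : ∀ {p q B δ} → 0ℚ ℚ.< B → ∣ p ∣ ℚ.≤ B → ∣ q ∣ ℚ.< δ → ∣ p ℚ.* q ∣ ℚ.< B ℚ.* δ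
  ∣*∣-bound {p} {q} {B} {δ} 0<B p≤B q<δ = begin-strict
      ∣ p ℚ.* q ∣      ≡⟨ ℚ.∣p*q∣≡∣p∣*∣q∣ p q ⟩
      ∣ p ∣ ℚ.* ∣ q ∣  ≤⟨ ℚ.*-monoʳ-≤-nonNeg ∣ q ∣ {{ℚ.nonNegative (ℚ.0≤∣p∣ q)}} p≤B ⟩
      B ℚ.* ∣ q ∣      <⟨ ℚ.*-monoʳ-<-pos B {{ℚ.positive 0<B}} q<δ ⟩
      B ℚ.* δ ∎
    where open ℚ.≤-Reasoning

  *-cauchy : ∀ {x y} → Cauchy x → Cauchy y → Cauchy (λ n → x n ℚ.* y n)
  *-cauchy {x} {y} cx cy e 0<e
    with cauchy-bounded cx | cauchy-bounded cy
  ... | B , 0<B , K , bx | C , 0<C , L , by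
    with pos-quotient 0<B (half-pos 0<e) | pos-quotient 0<C (half-pos 0<e)
  ... | δ , 0<δ , Bδ | η , 0<η , Cη
    with cx η 0<η | cy δ 0<δ
  ... | M , hx | N , hy = (K ℕ.⊔ L) ℕ.⊔ (M ℕ.⊔ N) , bound
    where
    open ℚ.≤-Reasoning
    bound : ∀ m n → (K ℕ.⊔ L) ℕ.⊔ (M ℕ.⊔ N) ℕ.≤ m → (K ℕ.⊔ L) ℕ.⊔ (M ℕ.⊔ N) ℕ.≤ n →
            ∣ x m ℚ.* y m ℚ.- x n ℚ.* y n ∣ ℚ.< e
    bound m n hm hn
      with ⊔-split {K ℕ.⊔ L} {M ℕ.⊔ N} hm | ⊔-split {K ℕ.⊔ L} {M ℕ.⊔ N} hn
    ... | KLm , MNm | KLn , MNn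
      with ⊔-split {K} {L} KLm | ⊔-split {M} {N} MNm
         | ⊔-split {K} {L} KLn | ⊔-split {M} {N} MNn
    ... | Km , _ | Mm , Nm | _ , Ln | Mn , Nn = begin-strict
      ∣ x m ℚ.* y m ℚ.- x n ℚ.* y n ∣
        ≡⟨ cong ∣_∣ (*-telescope (x m) (y m) (x n) (y n)) ⟩
      ∣ x m ℚ.* (y m ℚ.- y n) ℚ.+ y n ℚ.* (x m ℚ.- x n) ∣
        ≤⟨ ℚ.∣p+q∣≤∣p∣+∣q∣ (x m ℚ.* (y m ℚ.- y n)) (y n ℚ.* (x m ℚ.- x n)) ⟩
      ∣ x m ℚ.* (y m ℚ.- y n) ∣ ℚ.+ ∣ y n ℚ.* (x m ℚ.- x n) ∣
        <⟨ ℚ.+-mono-<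
             (∣*∣-bound {x m} {y m ℚ.- y n} 0<B (bx m Km) (hy m n Nm Nn))
             (∣*∣-bound {y n} {x m ℚ.- x n} 0<C (by n Ln) (hx m n Mm Mn)) ⟩
      B ℚ.* δ ℚ.+ C ℚ.* η
        ≡⟨ cong₂ ℚ._+_ Bδ Cη ⟩
      ½ ℚ.* e ℚ.+ ½ ℚ.* e
        ≡⟨ half+half e ⟩
      e ∎

fromℚ : ℚ → ℝ
fromℚ q = mkℝ (λ _ → q) (const-cauchy q)

0ℝ : ℝ
0ℝ = fromℚ 0ℚ

infixl 6 _+_
infixl 7 _*_

_+_ : ℝ → ℝ → ℝ
x + y = mkℝ (λ n → seq x n ℚ.+ seq y n) (+-cauchy {seq x} {seq y} (cauchy x) (cauchy y))

_*_ : ℝ → ℝ → ℝ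
x * y = mkℝ (λ n → seq x n ℚ.* seq y n) (*-cauchy {seq x} {seq y} (cauchy x) (cauchy y))

sumℝ : List ℝ → ℝ
sumℝ = foldr _+_ 0ℝ

Node : Set
Node = Fin 4

pattern a = 0F
pattern b = 1F
pattern c = 2F
pattern d = 3F

data Network : Set where
  A A⁺ : Network

data Link : Network → Node → Node → Set where
  ab : ∀ {N} → Link N a b
  bd : ∀ {N} → Link N b d
  bc : Link A⁺ b c
  ac : ∀ {N} → Link N a c
  cd : ∀ {N} → Link N c d

Path : Network → Set
Path N = Star (Link N) a d

P₁ P₂ : ∀ {N} → Path N
P₁ = ab ◅ bd ◅ ε
P₂ = ac ◅ cd ◅ ε

P₃ : Path A⁺
P₃ = ab ◅ bc ◅ cd ◅ ε

paths : ∀ N → List (Path N)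
paths A  = P₁ ∷ P₂ ∷ []
paths A⁺ = P₁ ∷ P₂ ∷ P₃ ∷ []

-- Every directed path from a to d occurs in the list exactly once, so sums
-- over the list are sums over all paths.

paths-complete : ∀ N (p : Path N) → p ∈ paths N
paths-complete A  (ab ◅ bd ◅ ε)      = here refl
paths-complete A  (ac ◅ cd ◅ ε)      = there (here refl)
paths-complete A⁺ (ab ◅ bd ◅ ε)      = here refl
paths-complete A⁺ (ac ◅ cd ◅ ε)      = there (here refl)
paths-complete A⁺ (ab ◅ bc ◅ cd ◅ ε) = there (there (here refl))

paths-unique : ∀ N → Unique (paths N)
paths-unique A  = ((λ ()) ∷ []) ∷ [] ∷ []
paths-unique A⁺ = ((λ ()) ∷ (λ ()) ∷ []) ∷ ((λ ()) ∷ []) ∷ [] ∷ []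

-- A link is determined by its end nodes, so it is enough to compare those.
_on_ : ∀ {N u v s t} → Link N u v → Star (Link N) s t → Bool
l on ε = false
_on_ {u = u} {v} l (_◅_ {s} {s′} _ p) =
  (does (u ≟ s) ∧ does (v ≟ s′)) ∨ (l on p)

record Parameters : Set where
  constructor params
  field
    α₁ α₂ α₃ β₁ β₂ β₃ : ℝ

Flow : Network → Set
Flow N = Path N → ℝ

IsFlow : ∀ N → ℝ → Flow N → Set
IsFlow N Q f = (∀ p → 0ℝ ≤ f p) × (sumℝ (map f (paths N)) ≈ Q)

linkFlow : ∀ {N u v} → Flow N → Link N u v → ℝ
linkFlow {N} f l = sumℝ (map f (filterᵇ (l on_) (paths N)))

module _ (θ : Parameters) where
  open Parameters θ

  linkTime : ∀ {N u v} → Link N u v → ℝ → ℝ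
  linkTime ab x = α₁ + β₁ * x
  linkTime bd x = α₂ + β₂ * x
  linkTime bc x = α₃ + β₃ * x
  linkTime ac x = α₁ + β₁ * x
  linkTime cd x = α₂ + β₂ * x

  pathTime : ∀ {N s t} → Flow N → Star (Link N) s t → ℝ
  pathTime f ε       = 0ℝ
  pathTime f (l ◅ p) = linkTime l (linkFlow f l) + pathTime f p

  -- The flow f is an equilibrium whose common travel time is T.
  IsEquilibrium : ∀ N → ℝ → Flow N → ℝ → Set
  IsEquilibrium N Q f T =
    IsFlow N Q f ×
    (∀ p → ¬ (f p ≈ 0ℝ) → pathTime f p ≈ T) ×
    (∀ p → f p ≈ 0ℝ → T ≤ pathTime f p)

  -- T is the (unique) equilibrium travel time of N at total flow Q.
  IsEquilibriumTime : ∀ N → ℝ → ℝ → Set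
  IsEquilibriumTime N Q T =
    (∃[ f ] IsEquilibrium N Q f T) ×
    (∀ f T′ → IsEquilibrium N Q f T′ → T′ ≈ T)

  EqualEquilibriumTimes : ℝ → Set
  EqualEquilibriumTimes Q =
    ∃[ T ] ∃[ T⁺ ] (IsEquilibriumTime A Q T × IsEquilibriumTime A⁺ Q T⁺ × T⁺ ≈ T)

record IsNondegenerateInterval (I : ℝ → Set) : Set where
  field
    convex        : ∀ {x y z} → I x → I z → x ≤ y → y ≤ z → I y
    nondegenerate : ∃[ x ] ∃[ y ] (I x × I y × x < y)

PseudoParadoxAt : Parameters → ℝ → Set₁
PseudoParadoxAt θ Q =
  Σ[ I ∈ (ℝ → Set) ]
    IsNondegenerateInterval I ×
    (∀ {Q′} → I Q′ → 0ℝ < Q′) ×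
    I Q ×
    (∀ {Q′} → I Q′ → EqualEquilibriumTimes θ Q′)

{-# OPTIONS --safe #-}
module Submission where

-- The half-half flow is an equilibrium of A⁺ because the detour P₃ costs at least α₃ more than
-- P₁ and P₂ when it is empty.  For uniqueness, suppose P₃ carries flow f₃ > 0, so that neither
-- P₁ nor P₂ is faster than P₃.  Sharing the first link, P₁ and P₃ compare by β₂f₁ against
-- α₃ + β₃f₃ + β₂(f₂ + f₃), which forces f₁ > f₂; sharing the last link, P₂ and P₃ force
-- f₂ > f₁.  Hence f₃ = 0, and then P₁ and P₂ have the same time only if f₁ = f₂ = Q/2.
-- The argument stays constructive because ≤ is defined as a negation and < is cotransitive.

open import Defs
open import Data.Empty using (⊥; ⊥-elim)
open import Data.Nat as ℕ using (ℕ)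
import Data.Nat.Properties as ℕ
open import Data.Product using (∃-syntax; _×_; _,_)
open import Data.Rational as ℚ using (ℚ; 0ℚ; 1ℚ; ½; ∣_∣; 1/_)
import Data.Rational.Properties as ℚ
open import Data.Rational.Solver using (module +-*-Solver)
open import Data.Sum using (_⊎_; inj₁; inj₂; [_,_]′)
open import Function using (_∘_)
open import Relation.Binary.Construct.Closure.ReflexiveTransitive using (ε; _◅_)
open import Relation.Binary.PropositionalEquality
open import Relation.Binary.Structures using (IsPreorder)
import Relation.Binary.Reasoning.Base.Triple as Triple
open import Relation.Nullary using (¬_; yes; no)
open import Relation.Nullary.Decidable using (from-yes)

open +-*-Solver using (solve; _:=_; _:+_; _:*_; _:-_; :-_; con)

-- Rational arithmetic

-- A strict inequality depends only on the difference of its sides. Linear consequences of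
-- inequalities thus reduce to ring identities, which the solver decides.
ℚ-<-by-difference : ∀ {p q r s} → p ℚ.< q → q ℚ.- p ≡ s ℚ.- r → r ℚ.< s
ℚ-<-by-difference {p} {q} {r} {s} p<q eq = begin-strict
  r                       ≡⟨ solve 2 (λ p r → r := (r :- p) :+ p) refl p r ⟩
  (r ℚ.- p) ℚ.+ p         <⟨ ℚ.+-monoʳ-< (r ℚ.- p) p<q ⟩
  (r ℚ.- p) ℚ.+ q         ≡⟨ solve 3 (λ p q r → (r :- p) :+ q := r :+ (q :- p)) refl p q r ⟩
  r ℚ.+ (q ℚ.- p)         ≡⟨ cong (r ℚ.+_) eq ⟩
  r ℚ.+ (s ℚ.- r)         ≡⟨ solve 2 (λ r s → r :+ (s :- r) := s) refl r s ⟩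
  s                       ∎
  where open ℚ.≤-Reasoning

p<q⇒0<q-p : ∀ {p q} → p ℚ.< q → 0ℚ ℚ.< q ℚ.- p
p<q⇒0<q-p {p} {q} p<q =
  ℚ-<-by-difference p<q (solve 2 (λ p q → q :- p := (q :- p) :- con 0ℚ) refl p q)

p≤∣p∣ : ∀ p → p ℚ.≤ ∣ p ∣
p≤∣p∣ p with 0ℚ ℚ.≤? p
... | yes 0≤p = ℚ.≤-reflexive (sym (ℚ.0≤p⇒∣p∣≡p 0≤p))
... | no  0≰p = ℚ.≤-trans (ℚ.<⇒≤ (ℚ.≰⇒> 0≰p)) (ℚ.0≤∣p∣ p)

∣p-q∣≡∣q-p∣ : ∀ p q → ∣ p ℚ.- q ∣ ≡ ∣ q ℚ.- p ∣
∣p-q∣≡∣q-p∣ p q = trans (sym (ℚ.∣-p∣≡∣p∣ (p ℚ.- q)))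
  (cong ∣_∣ (solve 2 (λ p q → :- (p :- q) := q :- p) refl p q))

∣p-q∣<e⇒p-q<e : ∀ p q {e} → ∣ p ℚ.- q ∣ ℚ.< e → p ℚ.- q ℚ.< e
∣p-q∣<e⇒p-q<e p q = ℚ.≤-<-trans (p≤∣p∣ (p ℚ.- q))

∣p-q∣<e⇒q-p<e : ∀ p q {e} → ∣ p ℚ.- q ∣ ℚ.< e → q ℚ.- p ℚ.< e
∣p-q∣<e⇒q-p<e p q {e} h = ∣p-q∣<e⇒p-q<e q p (subst (ℚ._< e) (∣p-q∣≡∣q-p∣ p q) h)

∣p-q∣<e : ∀ p q {e} → p ℚ.- q ℚ.< e → q ℚ.- p ℚ.< e → ∣ p ℚ.- q ∣ ℚ.< e
∣p-q∣<e p q {e} h₁ h₂ with ℚ.∣p∣≡p∨∣p∣≡-p (p ℚ.- q)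
... | inj₁ eq = subst (ℚ._< e) (sym eq) h₁
... | inj₂ eq = subst (ℚ._< e)
  (trans (solve 2 (λ p q → q :- p := :- (p :- q)) refl p q) (sym eq)) h₂

quotient : ∀ {p q} → 0ℚ ℚ.< p → 0ℚ ℚ.< q → ∃[ r ] (0ℚ ℚ.< r × p ℚ.* r ≡ q)
quotient {p} {q} 0<p 0<q = 1/ p ℚ.* q
  , subst (ℚ._< 1/ p ℚ.* q) (ℚ.*-zeroʳ (1/ p)) (ℚ.*-monoʳ-<-pos (1/ p) 0<q)
  , trans (sym (ℚ.*-assoc p (1/ p) q))
          (trans (cong (ℚ._* q) (ℚ.*-inverseʳ p)) (ℚ.*-identityˡ q))
  where
  instance
    p-positive : ℚ.Positive p
    p-positive = ℚ.positive 0<p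
    p-nonZero : ℚ.NonZero p
    p-nonZero = ℚ.pos⇒nonZero p
    1/p-positive : ℚ.Positive (1/ p)
    1/p-positive = ℚ.1/pos⇒pos p

p≡½*[p+p] : ∀ p → p ≡ ½ ℚ.* (p ℚ.+ p)
p≡½*[p+p] p = sym (trans
  (solve 2 (λ h p → h :* (p :+ p) := (h :+ h) :* p) refl ½ p) (ℚ.*-identityˡ p))

-- Cauchy sequences and the order of ℝ

eventually-zip : ∀ {P Q R : ℕ → Set} → Eventually P → Eventually Q →
                 (∀ n → P n → Q n → R n) → Eventually R
eventually-zip (M , p) (N , q) f = M ℕ.⊔ N , λ n h →
  f n (p n (ℕ.≤-trans (ℕ.m≤m⊔n M N) h)) (q n (ℕ.≤-trans (ℕ.m≤n⊔m M N) h))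

eventually-map : ∀ {P Q : ℕ → Set} → Eventually P → (∀ n → P n → Q n) → Eventually Q
eventually-map (N , p) f = N , λ n h → f n (p n h)

¬eventually-⊥ : ¬ Eventually (λ _ → ⊥)
¬eventually-⊥ (N , absurd) = absurd N ℕ.≤-refl

-- Constructive substitute for deciding the order: take `m` strictly between `q` and `r`. Late terms
-- of `x` stay close to one term `seq x K`, and the rationals `m` and `seq x K` can be compared; the
-- slack on either side of `m` absorbs the remaining oscillation.
locate : ∀ x {q r} → q ℚ.< r →
         Eventually (λ n → q ℚ.< seq x n) ⊎ Eventually (λ n → seq x n ℚ.< r)
locate x {q} {r} q<r = at (ℚ.<-dense q<r)
  where
  above : ∀ m u v → ∣ v ℚ.- u ∣ ℚ.< m ℚ.- q → m ℚ.≤ u → q ℚ.< v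
  above m u v close m≤u = ℚ-<-by-difference (ℚ.+-mono-<-≤ (∣p-q∣<e⇒q-p<e v u close) m≤u)
    (solve 4 (λ q m u v → ((m :- q) :+ u) :- ((u :- v) :+ m) := v :- q) refl q m u v)

  below : ∀ m u v → ∣ v ℚ.- u ∣ ℚ.< r ℚ.- m → u ℚ.≤ m → v ℚ.< r
  below m u v close u≤m = ℚ-<-by-difference (ℚ.+-mono-<-≤ (∣p-q∣<e⇒p-q<e v u close) u≤m)
    (solve 4 (λ r m u v → ((r :- m) :+ m) :- ((v :- u) :+ u) := r :- v) refl r m u v)

  Modulus : ℚ → Set
  Modulus e = ∃[ N ] (∀ m n → N ℕ.≤ m → N ℕ.≤ n → ∣ seq x m ℚ.- seq x n ∣ ℚ.< e)

  compare : ∀ m → Modulus (m ℚ.- q) → Modulus (r ℚ.- m) →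
            Eventually (λ n → q ℚ.< seq x n) ⊎ Eventually (λ n → seq x n ℚ.< r)
  compare m (M , close) (N , close′) =
    [ (λ m≤xK → inj₁ (K , λ n K≤n → above m (seq x K) (seq x n)
        (close n K (ℕ.≤-trans M≤K K≤n) M≤K) m≤xK))
    , (λ xK≤m → inj₂ (K , λ n K≤n → below m (seq x K) (seq x n)
        (close′ n K (ℕ.≤-trans N≤K K≤n) N≤K) xK≤m))
    ]′ (ℚ.≤-total m (seq x K))
    where
    K : ℕ
    -- `K` lies beyond both moduli, so the same sample term serves whichever way the comparison with
    -- `m` turns out.
    K = M ℕ.⊔ N
    M≤K : M ℕ.≤ K
    M≤K = ℕ.m≤m⊔n M N
    N≤K : N ℕ.≤ K
    N≤K = ℕ.m≤n⊔m M N

  at : ∃[ m ] (q ℚ.< m × m ℚ.< r) →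
       Eventually (λ n → q ℚ.< seq x n) ⊎ Eventually (λ n → seq x n ℚ.< r)
  at (m , q<m , m<r) = compare m
    (cauchy x (m ℚ.- q) (p<q⇒0<q-p q<m)) (cauchy x (r ℚ.- m) (p<q⇒0<q-p m<r))

infix  8 -_
infixl 6 _-_

-- Negation makes differences available as reals, so that comparing two reals becomes an application
-- of `locate` to their difference.
-_ : ℝ → ℝ
- x = mkℝ (λ n → ℚ.- seq x n) λ e 0<e → let N , close = cauchy x e 0<e in
  N , λ m n N≤m N≤n → subst (λ p → ∣ p ∣ ℚ.< e)
    (solve 2 (λ u v → v :- u := (:- u) :- (:- v)) refl (seq x m) (seq x n))
    (close n m N≤n N≤m)

_-_ : ℝ → ℝ → ℝ
x - y = x + - y

gap⇒< : ∀ {x y e} → 0ℚ ℚ.< e → Eventually (λ n → e ℚ.< seq (y - x) n) → x < y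
gap⇒< {x} {y} {e} 0<e gap = e , 0<e , eventually-map gap
  (λ n h → ℚ-<-by-difference h (solve 3 (λ x y e →
     (y :- x) :- e := y :- (x :+ e)) refl (seq x n) (seq y n) e))

-- With a margin `e` between `x` and `y`, choose `0 < q < r < e` and locate `z - x` against `q < r`.
-- Either `z` exceeds `x` by the margin `q`, or `z` stays below `x + r` and the margin `e - r` to
-- `y` remains.
<-cotrans : ∀ {x y} → x < y → ∀ z → x < z ⊎ z < y
<-cotrans {x} {y} (e , 0<e , x+e<y) z = at (ℚ.<-dense 0<e)
  where
  step : ∀ r u v w → u ℚ.+ e ℚ.< v → w ℚ.- u ℚ.< r → w ℚ.+ (e ℚ.- r) ℚ.< v
  step r u v w h₁ h₂ = ℚ-<-by-difference (ℚ.+-mono-< h₁ h₂)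
    (solve 5 (λ u v w e r →
      (v :+ r) :- ((u :+ e) :+ (w :- u)) := v :- (w :+ (e :- r)))
      refl u v w e r)

  at : ∃[ r ] (0ℚ ℚ.< r × r ℚ.< e) → x < z ⊎ z < y
  at (r , 0<r , r<e) = between (ℚ.<-dense 0<r)
    where
    between : ∃[ q ] (0ℚ ℚ.< q × q ℚ.< r) → x < z ⊎ z < y
    between (q , 0<q , q<r) = decide (locate (z - x) q<r)
      where
      decide : Eventually (λ n → q ℚ.< seq z n ℚ.- seq x n) ⊎
               Eventually (λ n → seq z n ℚ.- seq x n ℚ.< r) → x < z ⊎ z < y
      decide (inj₁ gap)   = inj₁ (gap⇒< {x} {z} 0<q gap)
      decide (inj₂ z-x<r) = inj₂ (e ℚ.- r , p<q⇒0<q-p r<e , eventually-zip x+e<y z-x<r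
        (λ n → step r (seq x n) (seq y n) (seq z n)))

<-asym : ∀ {x y} → x < y → ¬ (y < x)
<-asym {x} {y} (e , 0<e , h) (e′ , 0<e′ , h′) = ¬eventually-⊥ (eventually-zip h h′
  (λ n p q → ℚ.<-asym
    (ℚ.≤-<-trans (ℚ.≤-reflexive (sym (ℚ.+-identityʳ (seq x n))))
      (ℚ.<-trans (ℚ.+-monoʳ-< (seq x n) 0<e) p))
    (ℚ.≤-<-trans (ℚ.≤-reflexive (sym (ℚ.+-identityʳ (seq y n))))
      (ℚ.<-trans (ℚ.+-monoʳ-< (seq y n) 0<e′) q))))

<⇒≤ : ∀ {x y} → x < y → x ≤ y
<⇒≤ {x} {y} = <-asym {x} {y}

-- Cotransitivity turns the negative hypothesis into positive information: of the two alternatives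
-- for `x` between `y` and `z`, the one with `y < x` is refuted by `x ≤ y`.
≤-<-trans : ∀ {x y z} → x ≤ y → y < z → x < z
≤-<-trans {x} {y} {z} x≤y y<z = [ ⊥-elim ∘ x≤y , (λ x<z → x<z) ]′ (<-cotrans {y} {z} y<z x)

<-≤-trans : ∀ {x y z} → x < y → y ≤ z → x < z
<-≤-trans {x} {y} {z} x<y y≤z = [ (λ x<z → x<z) , ⊥-elim ∘ y≤z ]′ (<-cotrans {x} {y} x<y z)

≤-trans : ∀ {x y z} → x ≤ y → y ≤ z → x ≤ z
≤-trans {x} {y} {z} x≤y y≤z z<x = [ y≤z , x≤y ]′ (<-cotrans {z} {x} z<x y)

≈-sym : ∀ {x y} → x ≈ y → y ≈ x
≈-sym {x} {y} x≈y e 0<e = eventually-map (x≈y e 0<e)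
  (λ n → subst (ℚ._< e) (∣p-q∣≡∣q-p∣ (seq x n) (seq y n)))

≈⇒≤ : ∀ {x y} → x ≈ y → x ≤ y
≈⇒≤ {x} {y} x≈y (e , 0<e , h) = ¬eventually-⊥ (eventually-zip h (x≈y e 0<e)
  (λ n → contradictory (seq x n) (seq y n)))
  where
  contradictory : ∀ u v → v ℚ.+ e ℚ.< u → ∣ u ℚ.- v ∣ ℚ.< e → ⊥
  contradictory u v p q = ℚ.<-asym (∣p-q∣<e⇒p-q<e u v q)
    (ℚ-<-by-difference p (solve 3 (λ u v e → u :- (v :+ e) := (u :- v) :- e) refl u v e))

-- For each `e`, locating `x - y` against some `0 < q < e` leaves only the upper bound, since a gap
-- of `q` would give `y < x`. The symmetric bound completes the absolute value.
≤-antisym : ∀ {x y} → x ≤ y → y ≤ x → x ≈ y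
≤-antisym {x} {y} x≤y y≤x e 0<e = eventually-zip (below x y x≤y) (below y x y≤x)
  (λ n → ∣p-q∣<e (seq x n) (seq y n))
  where
  below : ∀ x y → x ≤ y → Eventually (λ n → seq x n ℚ.- seq y n ℚ.< e)
  below x y x≤y = at (ℚ.<-dense 0<e)
    where
    at : ∃[ q ] (0ℚ ℚ.< q × q ℚ.< e) → Eventually (λ n → seq x n ℚ.- seq y n ℚ.< e)
    at (q , 0<q , q<e) = decide (locate (x - y) q<e)
      where
      decide : Eventually (λ n → q ℚ.< seq x n ℚ.- seq y n) ⊎
               Eventually (λ n → seq x n ℚ.- seq y n ℚ.< e) →
               Eventually (λ n → seq x n ℚ.- seq y n ℚ.< e)
      decide (inj₁ gap)   = ⊥-elim (x≤y (gap⇒< {y} {x} 0<q gap))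
      decide (inj₂ x-y<e) = x-y<e

≗⇒≈ : ∀ {x y} → (∀ n → seq x n ≡ seq y n) → x ≈ y
≗⇒≈ {x} {y} eq e 0<e = 0 , λ n _ → subst (λ p → ∣ p ∣ ℚ.< e)
  (sym (trans (cong (ℚ._- seq y n) (eq n)) (ℚ.+-inverseʳ (seq y n)))) 0<e

≈-refl : ∀ {x} → x ≈ x
≈-refl {x} = ≗⇒≈ {x} {x} λ _ → refl

≈-trans : ∀ {x y z} → x ≈ y → y ≈ z → x ≈ z
≈-trans {x} {y} {z} x≈y y≈z = ≤-antisym {x} {z}
  (≤-trans {x} {y} {z} (≈⇒≤ {x} {y} x≈y) (≈⇒≤ {y} {z} y≈z))
  (≤-trans {z} {y} {x} (≈⇒≤ {z} {y} (≈-sym {y} {z} y≈z)) (≈⇒≤ {y} {x} (≈-sym {x} {y} x≈y)))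

≤-isPreorder : IsPreorder _≈_ _≤_
≤-isPreorder = record
  { isEquivalence = record
    { refl  = λ {x} → ≈-refl {x}
    ; sym   = λ {x} {y} → ≈-sym {x} {y}
    ; trans = λ {x} {y} {z} → ≈-trans {x} {y} {z}
    }
  ; reflexive = λ {x} {y} → ≈⇒≤ {x} {y}
  ; trans     = λ {x} {y} {z} → ≤-trans {x} {y} {z}
  }

module ≤-Reasoning = Triple ≤-isPreorder
  (λ {x} {y} → <-asym {x} {y})
  (λ {x} {y} {z} x<y → ≤-<-trans {x} {y} {z} (<⇒≤ {x} {y} x<y))
  ( (λ {x} {y} {z} y≈z x<y → <-≤-trans {x} {y} {z} x<y (≈⇒≤ {y} {z} y≈z))
  , (λ {x} {y} {z} y≈z y<x → ≤-<-trans {z} {y} {x} (≈⇒≤ {z} {y} (≈-sym {y} {z} y≈z)) y<x))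
  (λ {x} {y} → <⇒≤ {x} {y})
  (λ {x} {y} {z} → <-≤-trans {x} {y} {z})
  (λ {x} {y} {z} → ≤-<-trans {x} {y} {z})

-- Arithmetic of ℝ

fromℚ-mono-< : ∀ {p q} → p ℚ.< q → fromℚ p < fromℚ q
fromℚ-mono-< {p} {q} p<q with ℚ.<-dense p<q
... | r , p<r , r<q = r ℚ.- p , p<q⇒0<q-p p<r , 0 , λ _ _ →
  subst (ℚ._< q) (solve 2 (λ p r → r := p :+ (r :- p)) refl p r) r<q

+-monoʳ-< : ∀ x {y z} → y < z → x + y < x + z
+-monoʳ-< x {y} {z} (e , 0<e , h) = e , 0<e , eventually-map h
  (λ n h → ℚ-<-by-difference h (solve 4 (λ x y z e →
     z :- (y :+ e) := (x :+ z) :- ((x :+ y) :+ e)) refl (seq x n) (seq y n) (seq z n) e))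

+-cancelˡ-< : ∀ x {y z} → x + y < x + z → y < z
+-cancelˡ-< x {y} {z} (e , 0<e , h) = e , 0<e , eventually-map h
  (λ n h → ℚ-<-by-difference h (solve 4 (λ x y z e →
     (x :+ z) :- ((x :+ y) :+ e) := z :- (y :+ e)) refl (seq x n) (seq y n) (seq z n) e))

+-monoʳ-≤ : ∀ x {y z} → y ≤ z → x + y ≤ x + z
+-monoʳ-≤ x {y} {z} y≤z = y≤z ∘ +-cancelˡ-< x {z} {y}

+-identityʳ : ∀ x → x + 0ℝ ≈ x
+-identityʳ x = ≗⇒≈ {x + 0ℝ} {x} λ n → ℚ.+-identityʳ (seq x n)

+-congˡ : ∀ x {y z} → y ≈ z → x + y ≈ x + z
+-congˡ x {y} {z} y≈z = ≤-antisym {x + y} {x + z}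
  (+-monoʳ-≤ x {y} {z} (≈⇒≤ {y} {z} y≈z))
  (+-monoʳ-≤ x {z} {y} (≈⇒≤ {z} {y} (≈-sym {y} {z} y≈z)))

+-positive : ∀ {x y} → 0ℝ < x → 0ℝ < y → 0ℝ < x + y
+-positive {x} {y} 0<x 0<y = begin-strict
  0ℝ      <⟨ 0<x ⟩
  x       ≈⟨ +-identityʳ x ⟨
  x + 0ℝ  <⟨ +-monoʳ-< x {0ℝ} {y} 0<y ⟩
  x + y   ∎
  where open ≤-Reasoning

*-zeroʳ : ∀ x → x * 0ℝ ≈ 0ℝ
*-zeroʳ x = ≗⇒≈ {x * 0ℝ} {0ℝ} λ n → ℚ.*-zeroʳ (seq x n)

-- The margin of the product is the product of the margins: eventually
-- `x * y + δ * e < x * y + x * e < x * z`.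
*-monoʳ-<-pos : ∀ {x} → 0ℝ < x → ∀ {y z} → y < z → x * y < x * z
*-monoʳ-<-pos {x} (δ , 0<δ , δ<x) {y} {z} (e , 0<e , y+e<z) =
  δ ℚ.* e
  , subst (ℚ._< δ ℚ.* e) (ℚ.*-zeroʳ δ) (ℚ.*-monoʳ-<-pos δ {{ℚ.positive 0<δ}} 0<e)
  , eventually-zip δ<x y+e<z step
  where
  step : ∀ n → 0ℚ ℚ.+ δ ℚ.< seq x n → seq y n ℚ.+ e ℚ.< seq z n →
         seq x n ℚ.* seq y n ℚ.+ δ ℚ.* e ℚ.< seq x n ℚ.* seq z n
  step n p q = ℚ.<-trans
    (ℚ.+-monoʳ-< (seq x n ℚ.* seq y n) (ℚ.*-monoˡ-<-pos e {{ℚ.positive 0<e}} δ<xn))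
    (subst (ℚ._< seq x n ℚ.* seq z n) (ℚ.*-distribˡ-+ (seq x n) (seq y n) e)
      (ℚ.*-monoʳ-<-pos (seq x n) {{ℚ.positive (ℚ.<-trans 0<δ δ<xn)}} q))
    where
    δ<xn : δ ℚ.< seq x n
    δ<xn = subst (ℚ._< seq x n) (ℚ.+-identityˡ δ) p

eventually-bounded : ∀ x → ∃[ B ] (0ℚ ℚ.< B × Eventually (λ n → seq x n ℚ.< B))
eventually-bounded x with cauchy x 1ℚ (ℚ.positive⁻¹ 1ℚ)
... | N , close = 1ℚ ℚ.+ ∣ seq x N ∣
  , ℚ.+-mono-<-≤ (ℚ.positive⁻¹ 1ℚ) (ℚ.0≤∣p∣ (seq x N))
  , N , λ n N≤n → ℚ-<-by-difference
      (ℚ.+-mono-<-≤ (∣p-q∣<e⇒p-q<e (seq x n) (seq x N) (close n N N≤n ℕ.≤-refl)) (p≤∣p∣ (seq x N)))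
      (solve 3 (λ u v w → (con 1ℚ :+ w) :- ((v :- u) :+ u) := (con 1ℚ :+ w) :- v)
        refl (seq x N) (seq x n) ∣ seq x N ∣)

-- An eventual upper bound `B` of `x` makes `g = e / B` a margin between `y` and `z`: termwise `x *
-- (y + g) < x * y + B * g = x * y + e < x * z`, and the positive term of `x` cancels.
*-cancelˡ-<-pos : ∀ {x} → 0ℝ < x → ∀ {y z} → x * y < x * z → y < z
*-cancelˡ-<-pos {x} (δ , 0<δ , δ<x) {y} {z} (e , 0<e , h) = divide (eventually-bounded x)
  where
  step : ∀ {B g} → 0ℚ ℚ.< g → B ℚ.* g ≡ e → ∀ u v w → 0ℚ ℚ.+ δ ℚ.< u × u ℚ.< B →
         u ℚ.* v ℚ.+ e ℚ.< u ℚ.* w → v ℚ.+ g ℚ.< w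
  step {B} {g} 0<g Bg≡e u v w (δ<u , u<B) uv+e<uw =
    ℚ.*-cancelˡ-<-nonNeg u {{ℚ.nonNegative (ℚ.<⇒≤ 0<u)}} (begin-strict
      u ℚ.* (v ℚ.+ g)          ≡⟨ ℚ.*-distribˡ-+ u v g ⟩
      u ℚ.* v ℚ.+ u ℚ.* g      <⟨ ℚ.+-monoʳ-< (u ℚ.* v)
                                    (ℚ.*-monoˡ-<-pos g {{ℚ.positive 0<g}} u<B) ⟩
      u ℚ.* v ℚ.+ B ℚ.* g      ≡⟨ cong (u ℚ.* v ℚ.+_) Bg≡e ⟩
      u ℚ.* v ℚ.+ e            <⟨ uv+e<uw ⟩
      u ℚ.* w                  ∎)
    where
    open ℚ.≤-Reasoning
    0<u : 0ℚ ℚ.< u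
    0<u = ℚ.<-trans 0<δ (subst (ℚ._< u) (ℚ.+-identityˡ δ) δ<u)

  divide : ∃[ B ] (0ℚ ℚ.< B × Eventually (λ n → seq x n ℚ.< B)) → y < z
  divide (B , 0<B , x<B) = by-quotient (quotient 0<B 0<e)
    where
    by-quotient : ∃[ g ] (0ℚ ℚ.< g × B ℚ.* g ≡ e) → y < z
    by-quotient (g , 0<g , Bg≡e) = g , 0<g , eventually-zip
      (eventually-zip δ<x x<B (λ _ → _,_)) h
      (λ n → step 0<g Bg≡e (seq x n) (seq y n) (seq z n))

-- Both inequalities are contrapositives of cancellation, which is where positivity of the factor
-- enters.
*-congˡ-pos : ∀ {x} → 0ℝ < x → ∀ {y z} → y ≈ z → x * y ≈ x * z
*-congˡ-pos {x} 0<x {y} {z} y≈z = ≤-antisym {x * y} {x * z}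
  (≈⇒≤ {y} {z} y≈z ∘ *-cancelˡ-<-pos {x} 0<x {z} {y})
  (≈⇒≤ {z} {y} (≈-sym {y} {z} y≈z) ∘ *-cancelˡ-<-pos {x} 0<x {y} {z})

half : ℝ → ℝ
half = fromℚ ½ *_

0<½ : 0ℝ < fromℚ ½
0<½ = fromℚ-mono-< (ℚ.positive⁻¹ ½)

half-positive : ∀ {x} → 0ℝ < x → 0ℝ < half x
half-positive {x} 0<x = begin-strict
  0ℝ       ≈⟨ *-zeroʳ (fromℚ ½) ⟨
  half 0ℝ  <⟨ *-monoʳ-<-pos {fromℚ ½} 0<½ {0ℝ} {x} 0<x ⟩
  half x   ∎
  where open ≤-Reasoning

≈-half : ∀ {x y s} → x ≈ y → x + y ≈ s → x ≈ half s
≈-half {x} {y} {s} x≈y x+y≈s = begin-equality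
  x             ≈⟨ ≗⇒≈ {x} {half (x + x)} (p≡½*[p+p] ∘ seq x) ⟩
  half (x + x)  ≈⟨ *-congˡ-pos {fromℚ ½} 0<½ {x + x} {x + y} (+-congˡ x {x} {y} x≈y) ⟩
  half (x + y)  ≈⟨ *-congˡ-pos {fromℚ ½} 0<½ {x + y} {s} x+y≈s ⟩
  half s        ∎
  where open ≤-Reasoning

half+half : ∀ x → half x + (half x + 0ℝ) ≈ x
half+half x = ≗⇒≈ {half x + (half x + 0ℝ)} {x} λ n → ½p+[½p+0]≡p (seq x n)
  where
  ½p+[½p+0]≡p : ∀ p → ½ ℚ.* p ℚ.+ (½ ℚ.* p ℚ.+ 0ℚ) ≡ p
  ½p+[½p+0]≡p p = trans (cong (½ ℚ.* p ℚ.+_) (ℚ.+-identityʳ (½ ℚ.* p)))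
    (trans (sym (ℚ.*-distribˡ-+ ½ p p)) (sym (p≡½*[p+p] p)))

-- The equilibria of A and A⁺

-- Two paths with a common link: u is the time they share, the slower one adds the delay w.
detour-slower : ∀ {β z w} → 0ℝ < β → 0ℝ < z → 0ℝ < w →
                ∀ u {x y} → x ≤ y → u + β * x < u + (β * (y + z) + w)
detour-slower {β} {z} {w} 0<β 0<z 0<w u {x} {y} x≤y =
  +-monoʳ-< u {β * x} {β * (y + z) + w} (begin-strict
    β * x               <⟨ *-monoʳ-<-pos {β} 0<β {x} {y + z} x<y+z ⟩
    β * (y + z)         ≈⟨ +-identityʳ (β * (y + z)) ⟨
    β * (y + z) + 0ℝ    <⟨ +-monoʳ-< (β * (y + z)) {0ℝ} {w} 0<w ⟩
    β * (y + z) + w     ∎)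
  where
  open ≤-Reasoning
  x<y+z : x < y + z
  x<y+z = begin-strict
    x       ≤⟨ x≤y ⟩
    y       ≈⟨ +-identityʳ y ⟨
    y + 0ℝ  <⟨ +-monoʳ-< y {0ℝ} {z} 0<z ⟩
    y + z   ∎

-- Whether a path flow vanishes cannot be decided, but `T ≤ t` is a negation. A path faster than `T`
-- cannot be empty, so it has time `T`, a contradiction. The parameter `t` admits any closed form of
-- the path time.
equilibrium-minimal : ∀ θ {N Q f T} → IsEquilibrium θ N Q f T →
                      ∀ p {t} → pathTime θ f p ≈ t → T ≤ t
equilibrium-minimal θ {f = f} {T} (_ , used , unused) p {t} fp≈t =
  ≤-trans {T} {pathTime θ f p} {t} T≤fp (≈⇒≤ {pathTime θ f p} {t} fp≈t)
  where
  T≤fp : T ≤ pathTime θ f p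
  T≤fp fp<T = ≈⇒≤ {T} {pathTime θ f p} (≈-sym {pathTime θ f p} {T}
    (used p λ unused-p → unused p unused-p fp<T)) fp<T

-- Balancing two paths with the same time function

module _ (α₁ α₂ α₃ β₁ β₂ β₃ : ℝ)
         (0≤α₃ : 0ℝ ≤ α₃) (0<β₁ : 0ℝ < β₁) (0<β₂ : 0ℝ < β₂) (0<β₃ : 0ℝ < β₃) where

  private
    θ : Parameters
    θ = params α₁ α₂ α₃ β₁ β₂ β₃

  -- The common time function of `P₁` and `P₂` when the detour carries no flow.
  time : ℝ → ℝ
  time x = (α₁ + α₂) + (β₁ + β₂) * x

  time-mono-< : ∀ {x y} → x < y → time x < time y
  time-mono-< {x} {y} x<y = +-monoʳ-< (α₁ + α₂) {(β₁ + β₂) * x} {(β₁ + β₂) * y}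
    (*-monoʳ-<-pos {β₁ + β₂} (+-positive {β₁} {β₂} 0<β₁ 0<β₂) {x} {y} x<y)

  time-cong : ∀ {x y} → x ≈ y → time x ≈ time y
  time-cong {x} {y} x≈y = +-congˡ (α₁ + α₂) {(β₁ + β₂) * x} {(β₁ + β₂) * y}
    (*-congˡ-pos {β₁ + β₂} (+-positive {β₁} {β₂} 0<β₁ 0<β₂) {x} {y} x≈y)

  -- If `x < y`, then `y` is positive, so its path is used and takes time `T`; strict monotonicity
  -- then gives `time x < T`.
  not-faster : ∀ {x y T} → 0ℝ ≤ x → T ≤ time x → (¬ (y ≈ 0ℝ) → time y ≈ T) → y ≤ x
  not-faster {x} {y} {T} 0≤x T≤tx used x<y = T≤tx (begin-strict
    time x  <⟨ time-mono-< {x} {y} x<y ⟩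
    time y  ≈⟨ used (λ y≈0 → ≈⇒≤ {y} {0ℝ} y≈0 (≤-<-trans {0ℝ} {x} {y} 0≤x x<y)) ⟩
    T       ∎)
    where open ≤-Reasoning

  -- Applying `not-faster` in both directions gives `x ≈ y`, so each is `half Q`. This is positive,
  -- so the path is used and its time is `T`.
  balanced : ∀ {Q x y T} → 0ℝ < Q → 0ℝ ≤ x → 0ℝ ≤ y → x + y ≈ Q →
             T ≤ time x → T ≤ time y →
             (¬ (x ≈ 0ℝ) → time x ≈ T) → (¬ (y ≈ 0ℝ) → time y ≈ T) →
             T ≈ time (half Q)
  balanced {Q} {x} {y} {T} 0<Q 0≤x 0≤y x+y≈Q T≤tx T≤ty used-x used-y = begin-equality
    T              ≈⟨ used-x x≉0 ⟨
    time x         ≈⟨ time-cong {x} {half Q} x≈Q/2 ⟩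
    time (half Q)  ∎
    where
    open ≤-Reasoning
    x≈Q/2 : x ≈ half Q
    x≈Q/2 = ≈-half {x} {y} {Q} (≤-antisym {x} {y}
      (not-faster {y} {x} {T} 0≤y T≤ty used-x) (not-faster {x} {y} {T} 0≤x T≤tx used-y)) x+y≈Q
    x≉0 : ¬ (x ≈ 0ℝ)
    x≉0 x≈0 = ≈⇒≤ {half Q} {0ℝ}
      (≈-trans {half Q} {x} {0ℝ} (≈-sym {x} {half Q} x≈Q/2) x≈0) (half-positive {Q} 0<Q)

  -- Path times as functions of the path flows

  P₁-time-A : ∀ f → pathTime θ {A} f P₁ ≈ time (f P₁)
  P₁-time-A f = ≗⇒≈ {pathTime θ {A} f P₁} {time (f P₁)} λ n → solve 5
    (λ α₁ α₂ β₁ β₂ x → (α₁ :+ β₁ :* (x :+ con 0ℚ)) :+ ((α₂ :+ β₂ :* (x :+ con 0ℚ)) :+ con 0ℚ)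
      := (α₁ :+ α₂) :+ (β₁ :+ β₂) :* x)
    refl (seq α₁ n) (seq α₂ n) (seq β₁ n) (seq β₂ n) (seq (f P₁) n)

  P₂-time-A : ∀ f → pathTime θ {A} f P₂ ≈ time (f P₂)
  -- In `A` the two paths have the same link time functions, so the time of `P₂` is that of `P₁`
  -- under the constant flow `f P₂`.
  P₂-time-A f = P₁-time-A (λ _ → f P₂)

  -- The extra term is the load that `P₃` puts on the shared link `ab`. For `P₂` the shared link is
  -- `cd`, whence `β₂` in `P₂-time`.
  P₁-time : ∀ f → pathTime θ {A⁺} f P₁ ≈ time (f P₁) + β₁ * f P₃
  P₁-time f = ≗⇒≈ {pathTime θ {A⁺} f P₁} {time (f P₁) + β₁ * f P₃} λ n → solve 6
    (λ α₁ α₂ β₁ β₂ x z →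
      (α₁ :+ β₁ :* (x :+ (z :+ con 0ℚ))) :+ ((α₂ :+ β₂ :* (x :+ con 0ℚ)) :+ con 0ℚ)
      := ((α₁ :+ α₂) :+ (β₁ :+ β₂) :* x) :+ β₁ :* z)
    refl (seq α₁ n) (seq α₂ n) (seq β₁ n) (seq β₂ n) (seq (f P₁) n) (seq (f P₃) n)

  P₂-time : ∀ f → pathTime θ {A⁺} f P₂ ≈ time (f P₂) + β₂ * f P₃
  P₂-time f = ≗⇒≈ {pathTime θ {A⁺} f P₂} {time (f P₂) + β₂ * f P₃} λ n → solve 6
    (λ α₁ α₂ β₁ β₂ y z →
      (α₁ :+ β₁ :* (y :+ con 0ℚ)) :+ ((α₂ :+ β₂ :* (y :+ (z :+ con 0ℚ))) :+ con 0ℚ)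
      := ((α₁ :+ α₂) :+ (β₁ :+ β₂) :* y) :+ β₂ :* z)
    refl (seq α₁ n) (seq α₂ n) (seq β₁ n) (seq β₂ n) (seq (f P₂) n) (seq (f P₃) n)

  -- Emptiness of the detour at equilibrium

  module _ (f : Flow A⁺) where

    private
      x y z t₁ t₂ t₃ u₁ u₂ w : ℝ
      x = f P₁
      y = f P₂
      z = f P₃
      t₁ = pathTime θ f P₁
      t₂ = pathTime θ f P₂
      t₃ = pathTime θ f P₃
      -- `u₁` is the time on `ab` plus the constant `α₂` common to `bd` and `cd`; `u₂` is the time
      -- on `cd` plus the constant `α₁` common to `ac` and `ab`; `w` is the time on `bc`.
      u₁ = α₁ + α₂ + β₁ * (x + z)
      u₂ = α₁ + α₂ + β₂ * (y + z)
      w = β₃ * z + α₃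

    t₁-split : t₁ ≈ u₁ + β₂ * x
    t₁-split = ≗⇒≈ {t₁} {u₁ + β₂ * x} λ n → solve 6
      (λ α₁ α₂ β₁ β₂ x z →
        (α₁ :+ β₁ :* (x :+ (z :+ con 0ℚ))) :+ ((α₂ :+ β₂ :* (x :+ con 0ℚ)) :+ con 0ℚ)
        := (α₁ :+ α₂ :+ β₁ :* (x :+ z)) :+ β₂ :* x)
      refl (seq α₁ n) (seq α₂ n) (seq β₁ n) (seq β₂ n) (seq x n) (seq z n)

    t₂-split : t₂ ≈ u₂ + β₁ * y
    t₂-split = ≗⇒≈ {t₂} {u₂ + β₁ * y} λ n → solve 6
      (λ α₁ α₂ β₁ β₂ y z →
        (α₁ :+ β₁ :* (y :+ con 0ℚ)) :+ ((α₂ :+ β₂ :* (y :+ (z :+ con 0ℚ))) :+ con 0ℚ)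
        := (α₁ :+ α₂ :+ β₂ :* (y :+ z)) :+ β₁ :* y)
      refl (seq α₁ n) (seq α₂ n) (seq β₁ n) (seq β₂ n) (seq y n) (seq z n)

    -- The time of `P₃` is split in two ways, against `P₁` through `u₁` and against `P₂` through
    -- `u₂`, to match the form of `detour-slower`.
    t₃-split₁ : t₃ ≈ u₁ + (β₂ * (y + z) + w)
    t₃-split₁ = ≗⇒≈ {t₃} {u₁ + (β₂ * (y + z) + w)} λ n → solve 9
      (λ α₁ α₂ α₃ β₁ β₂ β₃ x y z →
        (α₁ :+ β₁ :* (x :+ (z :+ con 0ℚ))) :+ ((α₃ :+ β₃ :* (z :+ con 0ℚ)) :+
          ((α₂ :+ β₂ :* (y :+ (z :+ con 0ℚ))) :+ con 0ℚ))
        := (α₁ :+ α₂ :+ β₁ :* (x :+ z)) :+ (β₂ :* (y :+ z) :+ (β₃ :* z :+ α₃)))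
      refl (seq α₁ n) (seq α₂ n) (seq α₃ n) (seq β₁ n) (seq β₂ n) (seq β₃ n)
           (seq x n) (seq y n) (seq z n)

    t₃-split₂ : t₃ ≈ u₂ + (β₁ * (x + z) + w)
    t₃-split₂ = ≗⇒≈ {t₃} {u₂ + (β₁ * (x + z) + w)} λ n → solve 9
      (λ α₁ α₂ α₃ β₁ β₂ β₃ x y z →
        (α₁ :+ β₁ :* (x :+ (z :+ con 0ℚ))) :+ ((α₃ :+ β₃ :* (z :+ con 0ℚ)) :+
          ((α₂ :+ β₂ :* (y :+ (z :+ con 0ℚ))) :+ con 0ℚ))
        := (α₁ :+ α₂ :+ β₂ :* (y :+ z)) :+ (β₁ :* (x :+ z) :+ (β₃ :* z :+ α₃)))
      refl (seq α₁ n) (seq α₂ n) (seq α₃ n) (seq β₁ n) (seq β₂ n) (seq β₃ n)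
           (seq x n) (seq y n) (seq z n)

    detour-unused : ∀ {Q T} → IsEquilibrium θ A⁺ Q f T → f P₃ ≈ 0ℝ
    detour-unused {Q} {T} eq@((0≤f , _) , used , _) = ≤-antisym {z} {0ℝ} z≤0 (0≤f P₃)
      where
      z≤0 : z ≤ 0ℝ
      -- No case distinction between `x` and `y` is made: `x ≤ y` means that `y < x` is absurd, and
      -- `y < x` would give the refuted `y ≤ x`.
      z≤0 0<z = x≰y λ y<x → y≰x (<⇒≤ {y} {x} y<x)
        where
        open ≤-Reasoning
        0<w : 0ℝ < w
        0<w = begin-strict
          0ℝ             ≈⟨ *-zeroʳ β₃ ⟨
          β₃ * 0ℝ        <⟨ *-monoʳ-<-pos {β₃} 0<β₃ {0ℝ} {z} 0<z ⟩
          β₃ * z         ≈⟨ +-identityʳ (β₃ * z) ⟨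
          β₃ * z + 0ℝ    ≤⟨ +-monoʳ-≤ (β₃ * z) {0ℝ} {α₃} 0≤α₃ ⟩
          w              ∎
        t₃≈T : t₃ ≈ T
        t₃≈T = used P₃ λ z≈0 → ≈⇒≤ {z} {0ℝ} z≈0 0<z
        x≰y : ¬ (x ≤ y)
        x≰y x≤y = equilibrium-minimal θ {A⁺} {Q} {f} {T} eq P₁
          {u₁ + β₂ * x} t₁-split (begin-strict
          u₁ + β₂ * x                 <⟨ detour-slower {β₂} {z} {w} 0<β₂ 0<z 0<w u₁ {x} {y} x≤y ⟩
          u₁ + (β₂ * (y + z) + w)     ≈⟨ t₃-split₁ ⟨
          t₃                          ≈⟨ t₃≈T ⟩
          T                           ∎)
        y≰x : ¬ (y ≤ x)
        y≰x y≤x = equilibrium-minimal θ {A⁺} {Q} {f} {T} eq P₂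
          {u₂ + β₁ * y} t₂-split (begin-strict
          u₂ + β₁ * y                 <⟨ detour-slower {β₁} {z} {w} 0<β₁ 0<z 0<w u₂ {y} {x} y≤x ⟩
          u₂ + (β₁ * (x + z) + w)     ≈⟨ t₃-split₂ ⟨
          t₃                          ≈⟨ t₃≈T ⟩
          T                           ∎)

  -- Uniqueness of the equilibrium times

  equilibrium-A : ∀ {Q f T} → 0ℝ < Q → IsEquilibrium θ A Q f T → T ≈ time (half Q)
  equilibrium-A {Q} {f} {T} 0<Q eq@((0≤f , total) , used , _) =
    balanced {Q} {x} {y} {T} 0<Q (0≤f P₁) (0≤f P₂)
      (≈-trans {x + y} {x + (y + 0ℝ)} {Q}
        (+-congˡ x {y} {y + 0ℝ} (≈-sym {y + 0ℝ} {y} (+-identityʳ y))) total)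
      (minimal P₁ {time x} (P₁-time-A f)) (minimal P₂ {time y} (P₂-time-A f))
      (λ x≉0 → ≈-trans {time x} {pathTime θ f P₁} {T}
        (≈-sym {pathTime θ f P₁} {time x} (P₁-time-A f)) (used P₁ x≉0))
      (λ y≉0 → ≈-trans {time y} {pathTime θ f P₂} {T}
        (≈-sym {pathTime θ f P₂} {time y} (P₂-time-A f)) (used P₂ y≉0))
    where
    x y : ℝ
    x = f P₁
    y = f P₂
    minimal : ∀ p {t} → pathTime θ f p ≈ t → T ≤ t
    minimal = equilibrium-minimal θ {A} {Q} {f} {T} eq

  equilibrium-A⁺ : ∀ {Q f T} → 0ℝ < Q → IsEquilibrium θ A⁺ Q f T → T ≈ time (half Q)
  equilibrium-A⁺ {Q} {f} {T} 0<Q eq@((0≤f , total) , used , _) =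
    balanced {Q} {x} {y} {T} 0<Q (0≤f P₁) (0≤f P₂)
      (≈-trans {x + y} {x + (y + (z + 0ℝ))} {Q}
        (+-congˡ x {y} {y + (z + 0ℝ)} (≈-sym {y + (z + 0ℝ)} {y} y+z≈y)) total)
      (minimal P₁ {time x} t₁≈tx) (minimal P₂ {time y} t₂≈ty)
      (λ x≉0 → ≈-trans {time x} {pathTime θ f P₁} {T}
        (≈-sym {pathTime θ f P₁} {time x} t₁≈tx) (used P₁ x≉0))
      (λ y≉0 → ≈-trans {time y} {pathTime θ f P₂} {T}
        (≈-sym {pathTime θ f P₂} {time y} t₂≈ty) (used P₂ y≉0))
    where
    open ≤-Reasoning
    x y z : ℝ
    x = f P₁
    y = f P₂
    z = f P₃
    z≈0 : z ≈ 0ℝ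
    z≈0 = detour-unused f {Q} {T} eq
    y+z≈y : y + (z + 0ℝ) ≈ y
    y+z≈y = begin-equality
      y + (z + 0ℝ)  ≈⟨ +-congˡ y {z + 0ℝ} {z} (+-identityʳ z) ⟩
      y + z         ≈⟨ +-congˡ y {z} {0ℝ} z≈0 ⟩
      y + 0ℝ        ≈⟨ +-identityʳ y ⟩
      y             ∎
    without-detour : ∀ {β} t → 0ℝ < β → t + β * z ≈ t
    without-detour {β} t 0<β = begin-equality
      t + β * z   ≈⟨ +-congˡ t {β * z} {β * 0ℝ} (*-congˡ-pos {β} 0<β {z} {0ℝ} z≈0) ⟩
      t + β * 0ℝ  ≈⟨ +-congˡ t {β * 0ℝ} {0ℝ} (*-zeroʳ β) ⟩
      t + 0ℝ      ≈⟨ +-identityʳ t ⟩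
      t           ∎
    t₁≈tx : pathTime θ f P₁ ≈ time x
    t₁≈tx = ≈-trans {pathTime θ f P₁} {time x + β₁ * z} {time x}
      (P₁-time f) (without-detour {β₁} (time x) 0<β₁)
    t₂≈ty : pathTime θ f P₂ ≈ time y
    t₂≈ty = ≈-trans {pathTime θ f P₂} {time y + β₂ * z} {time y}
      (P₂-time f) (without-detour {β₂} (time y) 0<β₂)
    minimal : ∀ p {t} → pathTime θ f p ≈ t → T ≤ t
    minimal = equilibrium-minimal θ {A⁺} {Q} {f} {T} eq

  -- Existence of the equilibria

  even-flow-A : ∀ {Q} → 0ℝ < Q → IsEquilibrium θ A Q (λ _ → half Q) (time (half Q))
  even-flow-A {Q} 0<Q =
    ((λ _ → <⇒≤ {0ℝ} {half Q} (half-positive {Q} 0<Q)) , half+half Q)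
    , (λ p _ → same-time p)
    , (λ p _ → ≈⇒≤ {time (half Q)} {t p} (≈-sym {t p} {time (half Q)} (same-time p)))
    where
    t : Path A → ℝ
    t = pathTime θ (λ _ → half Q)
    same-time : ∀ p → t p ≈ time (half Q)
    same-time (ab ◅ bd ◅ ε) = P₁-time-A (λ _ → half Q)
    same-time (ac ◅ cd ◅ ε) = P₂-time-A (λ _ → half Q)

  even-flow : ℝ → Flow A⁺
  even-flow Q (ab ◅ bd ◅ ε)      = half Q
  even-flow Q (ac ◅ cd ◅ ε)      = half Q
  even-flow Q (ab ◅ bc ◅ cd ◅ ε) = 0ℝ

  even-flow-A⁺ : ∀ {Q} → 0ℝ < Q → IsEquilibrium θ A⁺ Q (even-flow Q) (time (half Q))
  even-flow-A⁺ {Q} 0<Q = (nonneg , total) , used , unused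
    where
    open ≤-Reasoning
    h : ℝ
    h = half Q
    t : Path A⁺ → ℝ
    t = pathTime θ (even-flow Q)
    without-detour : ∀ β s → s + β * 0ℝ ≈ s
    without-detour β s = ≈-trans {s + β * 0ℝ} {s + 0ℝ} {s}
      (+-congˡ s {β * 0ℝ} {0ℝ} (*-zeroʳ β)) (+-identityʳ s)
    t₁≈ : t P₁ ≈ time h
    t₁≈ = ≈-trans {t P₁} {time h + β₁ * 0ℝ} {time h}
      (P₁-time (even-flow Q)) (without-detour β₁ (time h))
    t₂≈ : t P₂ ≈ time h
    t₂≈ = ≈-trans {t P₂} {time h + β₂ * 0ℝ} {time h}
      (P₂-time (even-flow Q)) (without-detour β₂ (time h))
    -- With `P₃` empty, its links `ab` and `cd` each carry `h`, so it differs from the other paths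
    -- only by the free time `α₃` of `bc`.
    t₃≈ : t P₃ ≈ time h + α₃
    t₃≈ = ≗⇒≈ {t P₃} {time h + α₃} λ n → solve 7
      (λ α₁ α₂ α₃ β₁ β₂ β₃ x →
        (α₁ :+ β₁ :* (x :+ (con 0ℚ :+ con 0ℚ))) :+ ((α₃ :+ β₃ :* (con 0ℚ :+ con 0ℚ)) :+
          ((α₂ :+ β₂ :* (x :+ (con 0ℚ :+ con 0ℚ))) :+ con 0ℚ))
        := ((α₁ :+ α₂) :+ (β₁ :+ β₂) :* x) :+ α₃)
      refl (seq α₁ n) (seq α₂ n) (seq α₃ n) (seq β₁ n) (seq β₂ n) (seq β₃ n) (seq h n)

    nonneg : ∀ p → 0ℝ ≤ even-flow Q p
    nonneg (ab ◅ bd ◅ ε)      = <⇒≤ {0ℝ} {h} (half-positive {Q} 0<Q)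
    nonneg (ac ◅ cd ◅ ε)      = <⇒≤ {0ℝ} {h} (half-positive {Q} 0<Q)
    nonneg (ab ◅ bc ◅ cd ◅ ε) = ≈⇒≤ {0ℝ} {0ℝ} (≈-refl {0ℝ})

    total : h + (h + (0ℝ + 0ℝ)) ≈ Q
    -- The two zero summands at the end compute to a single `0ℚ`, so the identity for two paths
    -- applies as it is.
    total = half+half Q

    used : ∀ p → ¬ (even-flow Q p ≈ 0ℝ) → t p ≈ time h
    used (ab ◅ bd ◅ ε)      _   = t₁≈
    used (ac ◅ cd ◅ ε)      _   = t₂≈
    used (ab ◅ bc ◅ cd ◅ ε) 0≉0 = ⊥-elim (0≉0 (≈-refl {0ℝ}))

    unused : ∀ p → even-flow Q p ≈ 0ℝ → time h ≤ t p
    unused (ab ◅ bd ◅ ε)      _ = ≈⇒≤ {time h} {t P₁} (≈-sym {t P₁} {time h} t₁≈)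
    unused (ac ◅ cd ◅ ε)      _ = ≈⇒≤ {time h} {t P₂} (≈-sym {t P₂} {time h} t₂≈)
    unused (ab ◅ bc ◅ cd ◅ ε) _ = begin
      time h        ≈⟨ +-identityʳ (time h) ⟨
      time h + 0ℝ   ≤⟨ +-monoʳ-≤ (time h) {0ℝ} {α₃} 0≤α₃ ⟩
      time h + α₃   ≈⟨ t₃≈ ⟨
      t P₃          ∎

  equal-times : ∀ {Q} → 0ℝ < Q → EqualEquilibriumTimes θ Q
  equal-times {Q} 0<Q = T , T
    , (((λ _ → half Q) , even-flow-A {Q} 0<Q)
      , λ f T′ → equilibrium-A {Q} {f} {T′} 0<Q)
    , ((even-flow Q , even-flow-A⁺ {Q} 0<Q)
      , λ f T′ → equilibrium-A⁺ {Q} {f} {T′} 0<Q)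
    , ≈-refl {T}
    where
    T : ℝ
    T = time (half Q)

-- The interval of positive total flows

positive-isNondegenerateInterval : IsNondegenerateInterval (0ℝ <_)
positive-isNondegenerateInterval = record
  { convex        = λ {x} {y} 0<x _ x≤y _ → <-≤-trans {0ℝ} {x} {y} 0<x x≤y
  ; nondegenerate = fromℚ ½ , fromℚ 1ℚ , 0<½ , fromℚ-mono-< (ℚ.positive⁻¹ 1ℚ)
                  , fromℚ-mono-< (from-yes (½ ℚ.<? 1ℚ))
  }

corollary5 : (α₁ α₂ α₃ β₁ β₂ β₃ : ℝ) →
    0ℝ ≤ α₁ → 0ℝ ≤ α₂ → 0ℝ ≤ α₃ →
    0ℝ < β₁ → 0ℝ < β₂ → 0ℝ < β₃ →
    (Q : ℝ) → 0ℝ < Q →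
    PseudoParadoxAt (params α₁ α₂ α₃ β₁ β₂ β₃) Q ×
    EqualEquilibriumTimes (params α₁ α₂ α₃ β₁ β₂ β₃) Q
corollary5 α₁ α₂ α₃ β₁ β₂ β₃ _ _ 0≤α₃ 0<β₁ 0<β₂ 0<β₃ Q 0<Q =
  -- The half-line of all positive totals serves as the interval for every `Q`.
  ( (0ℝ <_) , positive-isNondegenerateInterval , (λ 0<Q′ → 0<Q′) , 0<Q
  , λ {Q′} → equal {Q′})
  , equal {Q} 0<Q
  where
  equal : ∀ {Q} → 0ℝ < Q → EqualEquilibriumTimes (params α₁ α₂ α₃ β₁ β₂ β₃) Q
  equal {Q} = equal-times α₁ α₂ α₃ β₁ β₂ β₃ 0≤α₃ 0<β₁ 0<β₂ 0<β₃ {Q}
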